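{- Let $\Sigma$ be a finite set of $n\times n$ matrices with nonnegative integer entries and $\rho(\Sigma)=1$. The set of norms $\{\|A\| : A\in\Sigma^{\star}\}$ is unbounded if and only if there exist a product $A\in\Sigma^{\star}$ and indices $i\neq j$ such that $$A_{i,i}\ge 1,\qquad A_{i,j}\ge 1,\qquad A_{j,j}\ge 1 .$$
   Context: $\Sigma^t$ denotes the set of all products of length $t$ of matrices from the nonempty set $\Sigma$, and $\Sigma^{\star}=\bigcup_{t\ge 0}\Sigma^t$ (the empty product being the identity matrix). The norm $\|\cdot\|$ is the sum of the absolute values of all entries. The joint spectral radius is $\rho(\Sigma)=\lim_{t\to\infty}\max\{\|A\|^{1/t}: A\in\Sigma^t\}$. -}

module Defs where

import Algebra.Properties.Semiring.Sum
open import Data.Bool.Base using (if_then_else_)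
open import Data.Empty using (⊥)
open import Data.Fin.Base using (Fin)
import Data.Fin.Properties as Fin
open import Data.Integer.Base using (+_)
open import Data.List.Base using (List; []; _∷_; foldr; map; cartesianProductWith)
open import Data.List.Membership.Propositional using (_∈_)
open import Data.Nat.Base as ℕ using (ℕ; zero; suc)
import Data.Nat.Properties as ℕ
open import Data.Product using (∃-syntax; _×_; _,_)
open import Data.Rational.Base as ℚ
  using (ℚ; 0ℚ; 1ℚ; _+_; _-_; -_; _*_; 1/_; _/_; _≤_; _<_; _⊓_; _⊔_; Positive; NonNegative)
open import Data.Rational.Properties
open import Data.Rational.Solver using (module +-*-Solver)
open import Data.Sum.Base using (_⊎_; inj₁; inj₂)
open import Data.Vec.Functional using (Vector)
open import Relation.Binary.Definitions using (tri<; tri≈; tri>)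
open import Relation.Binary.PropositionalEquality
  using (_≡_; refl; sym; trans; cong; subst; subst₂)
open import Relation.Nullary using (does; yes; no)

open import Algebra.Definitions.RawSemiring +-*-rawSemiring using (_^_)
open Algebra.Properties.Semiring.Sum ℕ.+-*-semiring using (sum)

------------------------------------------------------------------------
-- Dedekind reals

record ℝ : Set₁ where
  field
    L U         : ℚ → Set
    L-inhabited : ∃[ q ] L q
    U-inhabited : ∃[ q ] U q
    L-down      : ∀ {p q} → p < q → L q → L p
    U-up        : ∀ {p q} → p < q → U p → U q
    L-open      : ∀ {q} → L q → ∃[ r ] q < r × L r
    U-open      : ∀ {q} → U q → ∃[ r ] r < q × U r
    disjoint    : ∀ {q} → L q → U q → ⊥
    located     : ∀ {p q} → p < q → L p ⊎ U q

open ℝ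

infix 4 _<ᴿ_

_<ᴿ_ : ℝ → ℝ → Set
x <ᴿ y = ∃[ q ] U x q × L y q

p-1<p : ∀ p → p - 1ℚ < p
p-1<p p = subst (p - 1ℚ <_) (+-identityʳ p) (+-monoʳ-< p (negative⁻¹ (- 1ℚ)))

p<p+1 : ∀ p → p < p + 1ℚ
p<p+1 p = subst (_< p + 1ℚ) (+-identityʳ p) (+-monoʳ-< p (positive⁻¹ 1ℚ))

fromℚ : ℚ → ℝ
fromℚ p = record
  { L           = _< p
  ; U           = p <_
  ; L-inhabited = p - 1ℚ , p-1<p p
  ; U-inhabited = p + 1ℚ , p<p+1 p
  ; L-down      = <-trans
  ; U-up        = λ p<q r<p → <-trans r<p p<q
  ; L-open      = <-dense
  ; U-open      = λ p<q → let r , p<r , r<q = <-dense p<q in r , r<q , p<r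
  ; disjoint    = <-asym
  ; located     = located′
  }
  where
  located′ : ∀ {q r} → q < r → q < p ⊎ p < r
  located′ {q} q<r with q <? p
  ... | yes q<p = inj₁ q<p
  ... | no  q≮p = inj₂ (≤-<-trans (≮⇒≥ q≮p) q<r)

0ᴿ 1ᴿ : ℝ
0ᴿ = fromℚ 0ℚ
1ᴿ = fromℚ 1ℚ

p-q+q≡p : ∀ p q → p - q + q ≡ p
p-q+q≡p = solve 2 (λ p q → p :- q :+ q := p) refl
  where open +-*-Solver

p+q-q≡p : ∀ p q → p + q - q ≡ p
p+q-q≡p = solve 2 (λ p q → p :+ q :- q := p) refl
  where open +-*-Solver

infixl 6 _+ᴿ_

_+ᴿ_ : ℝ → ℚ → ℝ
x +ᴿ ε = record
  { L           = λ q → L x (q - ε)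
  ; U           = λ q → U x (q - ε)
  ; L-inhabited = let q , l = L-inhabited x in q + ε , subst (L x) (sym (p+q-q≡p q ε)) l
  ; U-inhabited = let q , u = U-inhabited x in q + ε , subst (U x) (sym (p+q-q≡p q ε)) u
  ; L-down      = λ p<q → L-down x (+-monoˡ-< (- ε) p<q)
  ; U-up        = λ p<q → U-up x (+-monoˡ-< (- ε) p<q)
  ; L-open      = λ {q} l → let r , q-ε<r , lr = L-open x l in
      r + ε , subst (_< r + ε) (p-q+q≡p q ε) (+-monoˡ-< ε q-ε<r)
            , subst (L x) (sym (p+q-q≡p r ε)) lr
  ; U-open      = λ {q} u → let r , r<q-ε , ur = U-open x u in
      r + ε , subst (r + ε <_) (p-q+q≡p q ε) (+-monoˡ-< ε r<q-ε)
            , subst (U x) (sym (p+q-q≡p r ε)) ur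
  ; disjoint    = disjoint x
  ; located     = λ p<q → located x (+-monoˡ-< (- ε) p<q)
  }

⊔-< : ∀ {p q r} → p < r → q < r → p ⊔ q < r
⊔-< {p} {q} {r} p<r q<r with ⊔-sel p q
... | inj₁ e = subst (_< r) (sym e) p<r
... | inj₂ e = subst (_< r) (sym e) q<r

<-⊓ : ∀ {p q r} → r < p → r < q → r < p ⊓ q
<-⊓ {p} {q} {r} r<p r<q with ⊓-sel p q
... | inj₁ e = subst (r <_) (sym e) r<p
... | inj₂ e = subst (r <_) (sym e) r<q

U-up-≤ : ∀ x {p q} → p ≤ q → U x p → U x q
U-up-≤ x {p} p≤q u = let r , r<p , ur = U-open x u in U-up x (<-≤-trans r<p p≤q) ur

infixl 6 _⊔ᴿ_

_⊔ᴿ_ : ℝ → ℝ → ℝ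
x ⊔ᴿ y = record
  { L           = λ q → L x q ⊎ L y q
  ; U           = λ q → U x q × U y q
  ; L-inhabited = let q , l = L-inhabited x in q , inj₁ l
  ; U-inhabited = let p , u = U-inhabited x ; q , v = U-inhabited y in
      p ⊔ q , U-up-≤ x (p≤p⊔q p q) u , U-up-≤ y (p≤q⊔p p q) v
  ; L-down      = λ where
      p<q (inj₁ l) → inj₁ (L-down x p<q l)
      p<q (inj₂ l) → inj₂ (L-down y p<q l)
  ; U-up        = λ p<q (u , v) → U-up x p<q u , U-up y p<q v
  ; L-open      = λ where
      (inj₁ l) → let r , q<r , lr = L-open x l in r , q<r , inj₁ lr
      (inj₂ l) → let r , q<r , lr = L-open y l in r , q<r , inj₂ lr
  ; U-open      = λ (u , v) →
      let p , p<r , up = U-open x u ; q , q<r , vq = U-open y v in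
      p ⊔ q , ⊔-< p<r q<r , U-up-≤ x (p≤p⊔q p q) up , U-up-≤ y (p≤q⊔p p q) vq
  ; disjoint    = λ where
      (inj₁ l) (u , v) → disjoint x l u
      (inj₂ l) (u , v) → disjoint y l v
  ; located     = located′
  }
  where
  located′ : ∀ {p q} → p < q → (L x p ⊎ L y p) ⊎ (U x q × U y q)
  located′ p<q with located x p<q | located y p<q
  ... | inj₁ l | _      = inj₁ (inj₁ l)
  ... | inj₂ _ | inj₁ l = inj₁ (inj₂ l)
  ... | inj₂ u | inj₂ v = inj₂ (u , v)

_⟶_ : (ℕ → ℝ) → ℝ → Set
x ⟶ ℓ = ∀ ε → 0ℚ < ε → ∃[ N ] ∀ t → N ℕ.≤ t → (x t <ᴿ ℓ +ᴿ ε) × (ℓ <ᴿ x t +ᴿ ε)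

------------------------------------------------------------------------
-- Roots of natural numbers

*-mono-≤-nonNeg : ∀ {p q r s} → 0ℚ ≤ p → 0ℚ ≤ r → p ≤ q → r ≤ s → p * r ≤ q * s
*-mono-≤-nonNeg {p} {q} {r} {s} 0≤p 0≤r p≤q r≤s = ≤-trans
  (*-monoʳ-≤-nonNeg r {{ℚ.nonNegative 0≤r}} p≤q)
  (*-monoˡ-≤-nonNeg q {{ℚ.nonNegative (≤-trans 0≤p p≤q)}} r≤s)

0≤* : ∀ {p q} → 0ℚ ≤ p → 0ℚ ≤ q → 0ℚ ≤ p * q
0≤* = *-mono-≤-nonNeg {0ℚ} {r = 0ℚ} ≤-refl ≤-refl

0≤^ : ∀ k {p} → 0ℚ ≤ p → 0ℚ ≤ p ^ k
0≤^ zero    0≤p = nonNegative⁻¹ 1ℚ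
0≤^ (suc k) 0≤p = 0≤* 0≤p (0≤^ k 0≤p)

0<^ : ∀ k {p} → 0ℚ < p → 0ℚ < p ^ k
0<^ zero        0<p = positive⁻¹ 1ℚ
0<^ (suc k) {p} 0<p =
  positive⁻¹ _ {{pos*pos⇒pos p {{ℚ.positive 0<p}} (p ^ k) {{ℚ.positive (0<^ k 0<p)}}}}

1≤^ : ∀ k {p} → 1ℚ ≤ p → 1ℚ ≤ p ^ k
1≤^ zero    1≤p = ≤-refl
1≤^ (suc k) 1≤p =
  *-mono-≤-nonNeg {1ℚ} {r = 1ℚ} (nonNegative⁻¹ 1ℚ) (nonNegative⁻¹ 1ℚ) 1≤p (1≤^ k 1≤p)

^-mono-≤ : ∀ k {p q} → 0ℚ ≤ p → p ≤ q → p ^ k ≤ q ^ k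
^-mono-≤ zero    0≤p p≤q = ≤-refl
^-mono-≤ (suc k) 0≤p p≤q = *-mono-≤-nonNeg 0≤p (0≤^ k 0≤p) p≤q (^-mono-≤ k 0≤p p≤q)

^-mono-< : ∀ k {p q} → 0ℚ ≤ p → p < q → p ^ suc k < q ^ suc k
^-mono-< k {p} {q} 0≤p p<q = ≤-<-trans
  (*-monoˡ-≤-nonNeg p {{ℚ.nonNegative 0≤p}} (^-mono-≤ k 0≤p (<⇒≤ p<q)))
  (*-monoˡ-<-pos (q ^ k) {{ℚ.positive (0<^ k (≤-<-trans 0≤p p<q))}} p<q)

quotient : ∀ x c → 0ℚ < x → ∃[ z ] x * z ≡ c
quotient x c 0<x = 1/x * c , trans (sym (*-assoc x 1/x c))
  (trans (cong (_* c) (*-inverseʳ x {{pos⇒nonZero x {{ℚ.positive 0<x}}}})) (*-identityˡ c))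
  where 1/x = (1/ x) {{pos⇒nonZero x {{ℚ.positive 0<x}}}}

*-openʳ-< : ∀ {x y c} → 0ℚ < x → x * y < c → ∃[ z ] y < z × x * z < c
*-openʳ-< {x} {y} {c} 0<x xy<c =
  let z , xz≡c = quotient x c 0<x
      w , y<w , w<z = <-dense (*-cancelˡ-<-nonNeg x {{ℚ.nonNegative (<⇒≤ 0<x)}}
                                (subst (x * y <_) (sym xz≡c) xy<c))
  in w , y<w , subst (x * w <_) xz≡c (*-monoʳ-<-pos x {{ℚ.positive 0<x}} w<z)

*-openʳ-> : ∀ {x y c} → 0ℚ < x → c < x * y → ∃[ z ] z < y × c < x * z
*-openʳ-> {x} {y} {c} 0<x c<xy =
  let z , xz≡c = quotient x c 0<x
      w , z<w , w<y = <-dense (*-cancelˡ-<-nonNeg x {{ℚ.nonNegative (<⇒≤ 0<x)}}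
                                (subst (_< x * y) (sym xz≡c) c<xy))
  in w , w<y , subst (_< x * w) xz≡c (*-monoʳ-<-pos x {{ℚ.positive 0<x}} z<w)

*-open-< : ∀ {x y c} → 0ℚ ≤ x → 0ℚ ≤ y → x * y < c →
           ∃[ x′ ] ∃[ y′ ] x < x′ × y < y′ × x′ * y′ < c
*-open-< {x} {y} {c} 0≤x 0≤y xy<c =
  let y′ , y<y′ , xy′<c = step
      x′ , x<x′ , y′x′<c = *-openʳ-< (≤-<-trans 0≤y y<y′) (subst (_< c) (*-comm x y′) xy′<c)
  in x′ , y′ , x<x′ , y<y′ , subst (_< c) (*-comm y′ x′) y′x′<c
  where
  step : ∃[ y′ ] y < y′ × x * y′ < c
  step with <-cmp 0ℚ x
  ... | tri< 0<x _ _  = *-openʳ-< 0<x xy<c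
  ... | tri≈ _ refl _ = y + 1ℚ , p<p+1 y
                      , subst (_< c) (trans (*-zeroˡ y) (sym (*-zeroˡ (y + 1ℚ)))) xy<c
  ... | tri> _ _ x<0  with () ← <-irrefl refl (<-≤-trans x<0 0≤x)

^-open-< : ∀ k {q c} → 0ℚ ≤ q → q ^ k < c → ∃[ r ] q < r × r ^ k < c
^-open-< zero    {q} 0≤q 1<c = q + 1ℚ , p<p+1 q , 1<c
^-open-< (suc k) {q} 0≤q lt =
  let x′ , y′ , q<x′ , qᵏ<y′ , x′y′<c = *-open-< 0≤q (0≤^ k 0≤q) lt
      r , q<r , rᵏ<y′ = ^-open-< k 0≤q qᵏ<y′
      m = x′ ⊓ r
      q<m = <-⊓ q<x′ q<r
      0≤m = ≤-trans 0≤q (<⇒≤ q<m)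
  in m , q<m , ≤-<-trans
       (*-mono-≤-nonNeg 0≤m (0≤^ k 0≤m) (p⊓q≤p x′ r)
         (≤-trans (^-mono-≤ k 0≤m (p⊓q≤q x′ r)) (<⇒≤ rᵏ<y′)))
       x′y′<c

*-pos-cancel : ∀ {x y} → 0ℚ < x → 0ℚ < x * y → 0ℚ < y
*-pos-cancel {x} {y} 0<x 0<xy = *-cancelˡ-<-nonNeg x {{ℚ.nonNegative (<⇒≤ 0<x)}}
  (subst (_< x * y) (sym (*-zeroʳ x)) 0<xy)

^-open-> : ∀ k {q c} → 0ℚ < q → 0ℚ ≤ c → c < q ^ k → ∃[ r ] r < q × 0ℚ < r × c < r ^ k
^-open-> zero        0<q 0≤c c<1 = let r , 0<r , r<q = <-dense 0<q in r , r<q , 0<r , c<1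
^-open-> (suc k) {q} {c} 0<q 0≤c lt =
  let y′ , y′<qᵏ , c<qy′ = *-openʳ-> 0<q lt
      0<y′ = *-pos-cancel 0<q (≤-<-trans 0≤c c<qy′)
      x′ , x′<q , c<y′x′ = *-openʳ-> 0<y′ (subst (c <_) (*-comm q y′) c<qy′)
      0<x′ = *-pos-cancel 0<y′ (≤-<-trans 0≤c c<y′x′)
      r , r<q , 0<r , y′<rᵏ = ^-open-> k 0<q (<⇒≤ 0<y′) y′<qᵏ
  in x′ ⊔ r , ⊔-< x′<q r<q , <-≤-trans 0<r (p≤q⊔p x′ r) , <-≤-trans
       (subst (c <_) (*-comm y′ x′) c<y′x′)
       (*-mono-≤-nonNeg (<⇒≤ 0<x′) (<⇒≤ 0<y′) (p≤p⊔q x′ r)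
         (≤-trans (<⇒≤ y′<rᵏ) (^-mono-≤ k (<⇒≤ 0<r) (p≤q⊔p x′ r))))

fromℕ : ℕ → ℚ
fromℕ a = + a / 1

-- root k a is the nonnegative real a^(1/(k+1)).
root : ℕ → ℕ → ℝ
root k a = record
  { L           = λ q → q < 0ℚ ⊎ q ^ suc k < α
  ; U           = λ q → 0ℚ < q × α < q ^ suc k
  ; L-inhabited = - 1ℚ , inj₁ (negative⁻¹ (- 1ℚ))
  ; U-inhabited = α + 1ℚ , 0<α+1 , <-≤-trans (p<p+1 α)
      (subst (_≤ (α + 1ℚ) ^ suc k) (*-identityʳ (α + 1ℚ))
        (*-monoˡ-≤-nonNeg (α + 1ℚ) {{ℚ.nonNegative (<⇒≤ 0<α+1)}} (1≤^ k 1≤α+1)))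
  ; L-down      = L-down′
  ; U-up        = λ p<q (0<p , α<pᵗ) →
      <-trans 0<p p<q , <-trans α<pᵗ (^-mono-< k (<⇒≤ 0<p) p<q)
  ; L-open      = L-open′
  ; U-open      = λ (0<q , α<qᵗ) →
      let r , r<q , 0<r , α<rᵗ = ^-open-> (suc k) 0<q 0≤α α<qᵗ in r , r<q , 0<r , α<rᵗ
  ; disjoint    = λ where
      (inj₁ q<0)  (0<q , _)    → <-asym q<0 0<q
      (inj₂ qᵗ<α) (_ , α<qᵗ) → <-asym qᵗ<α α<qᵗ
  ; located     = located′
  }
  where
  α : ℚ
  α = fromℕ a

  0≤α : 0ℚ ≤ α
  0≤α = nonNegative⁻¹ α {{normalize-nonNeg a 1}}

  1≤α+1 : 1ℚ ≤ α + 1ℚ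
  1≤α+1 = subst (_≤ α + 1ℚ) (+-identityˡ 1ℚ) (+-monoˡ-≤ 1ℚ 0≤α)

  0<α+1 : 0ℚ < α + 1ℚ
  0<α+1 = <-≤-trans (positive⁻¹ 1ℚ) 1≤α+1

  L-down′ : ∀ {p q} → p < q → q < 0ℚ ⊎ q ^ suc k < α → p < 0ℚ ⊎ p ^ suc k < α
  L-down′ {p} p<q (inj₁ q<0)  = inj₁ (<-trans p<q q<0)
  L-down′ {p} p<q (inj₂ qᵗ<α) with p <? 0ℚ
  ... | yes p<0 = inj₁ p<0
  ... | no  p≮0 = inj₂ (<-trans (^-mono-< k (≮⇒≥ p≮0) p<q) qᵗ<α)

  L-open′ : ∀ {q} → q < 0ℚ ⊎ q ^ suc k < α → ∃[ r ] q < r × (r < 0ℚ ⊎ r ^ suc k < α)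
  L-open′ {q} l with q <? 0ℚ | l
  ... | yes q<0 | _         = let r , q<r , r<0 = <-dense q<0 in r , q<r , inj₁ r<0
  ... | no  q≮0 | inj₁ q<0  with () ← q≮0 q<0
  ... | no  q≮0 | inj₂ qᵗ<α =
    let r , q<r , rᵗ<α = ^-open-< (suc k) (≮⇒≥ q≮0) qᵗ<α in r , q<r , inj₂ rᵗ<α

  located′ : ∀ {p q} → p < q → (p < 0ℚ ⊎ p ^ suc k < α) ⊎ (0ℚ < q × α < q ^ suc k)
  located′ {p} p<q with p <? 0ℚ | p ^ suc k <? α
  ... | yes p<0 | _        = inj₁ (inj₁ p<0)
  ... | no  _   | yes pᵗ<α = inj₁ (inj₂ pᵗ<α)
  ... | no  p≮0 | no  pᵗ≮α = inj₂
    ( ≤-<-trans (≮⇒≥ p≮0) p<q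
    , ≤-<-trans (≮⇒≥ pᵗ≮α) (^-mono-< k (≮⇒≥ p≮0) p<q) )

------------------------------------------------------------------------
-- Matrices over ℕ and the joint spectral radius

Matrix : ℕ → Set
Matrix n = Vector (Vector ℕ n) n

infixl 7 _·_

_·_ : ∀ {n} → Matrix n → Matrix n → Matrix n
(A · B) i j = sum (λ k → A i k ℕ.* B k j)

I : ∀ {n} → Matrix n
I i j = if does (i Fin.≟ j) then 1 else 0

‖_‖ : ∀ {n} → Matrix n → ℕ
‖ A ‖ = sum (λ i → sum (λ j → A i j))

-- A finite set of matrices is given by a list enumerating it.
infixr 8 _^ˢ_

_^ˢ_ : ∀ {n} → List (Matrix n) → ℕ → List (Matrix n)
Σ ^ˢ zero  = I ∷ []
Σ ^ˢ suc t = cartesianProductWith _·_ Σ (Σ ^ˢ t)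

infix 4 _∈⋆_

_∈⋆_ : ∀ {n} → Matrix n → List (Matrix n) → Set
A ∈⋆ Σ = ∃[ t ] A ∈ Σ ^ˢ t

-- On a nonempty list of nonnegative reals, such as the roots below, the base
-- value 0ᴿ does not affect the maximum.
max : List ℝ → ℝ
max = foldr _⊔ᴿ_ 0ᴿ

-- The sequence is indexed from length 1, as ‖A‖^(1/t) is meaningless at t = 0.
maxRoot : ∀ {n} → List (Matrix n) → ℕ → ℝ
maxRoot Σ k = max (map (λ A → root k ‖ A ‖) (Σ ^ˢ suc k))

JointSpectralRadius : ∀ {n} → List (Matrix n) → ℝ → Set
JointSpectralRadius Σ ρ = maxRoot Σ ⟶ ρ

Norms : ∀ {n} → List (Matrix n) → ℕ → Set
Norms Σ m = ∃[ A ] A ∈⋆ Σ × m ≡ ‖ A ‖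

Unbounded : (ℕ → Set) → Set
Unbounded S = ∀ K → ∃[ m ] S m × K ℕ.< m

{-# OPTIONS --safe #-}

-- If ρ(Σ) = 1, then no product has a diagonal entry ≥ 2, since its powers would
-- grow exponentially.  Read a product as a word whose entry (p , q) counts the
-- walks from p to q, and colour each position of the word by the set of states
-- reachable from p and the set of states leading to q.  There are only 4ⁿ
-- colours, so a large entry forces a factor x between two positions of equal
-- colour with an entry x k l ≥ 2, where k is reachable from p and l leads to q.
-- By the equality of colours one can follow predecessors along x from k and
-- successors along x from l for ever; both walks run into loops, at states a
-- and b, joined by a walk a → k → l → b.  All this happens along powers of x,
-- whose lengths can be equalised.  If a = b, then l leads back to k, and the
-- product of that closed walk has a diagonal entry ≥ 2; hence a ≠ b.
module Submission where

open import Defs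
import Algebra.Properties.Semiring.Exp
import Algebra.Properties.Semiring.Sum
import Data.Integer.Base as ℤ
import Data.Integer.Properties as ℤ
import Data.Rational.Base as ℚ
import Data.Rational.Properties as ℚ
import Data.Rational.Unnormalised.Base as ℚᵘ
import Data.Rational.Unnormalised.Properties as ℚᵘ
open import Algebra.Bundles using (CommutativeRing)
open import Algebra.Definitions.RawSemiring ℚ.+-*-rawSemiring using () renaming (_^_ to _^ℚ_)
open import Data.Bool.Base using (true; false)
open import Data.Fin.Base using (Fin; zero; suc; toℕ; combine; funToFin; finToFun)
open import Data.Fin.Properties as Fin
  using (combine-injective; finToFun-funToFin; pigeonhole; nonZeroIndex)
open import Data.Fin.Subset using (Subset; _-_; ∣_∣; ⊤) renaming (_∈_ to _∈ˢ_)
open import Data.Fin.Subset.Properties using (∈⊤; ∣⊤∣≡n; x∈p∧x≢y⇒x∈p-y; x∈p⇒∣p-x∣<∣p∣)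
open import Data.List.Base
  using (List; []; _∷_; _++_; map; foldr; length; concat; replicate; take; drop)
open import Data.List.Membership.Propositional using (_∈_)
open import Data.List.Membership.Propositional.Properties
  using (∈-cartesianProductWith⁺; ∈-cartesianProductWith⁻; ∈-map⁺)
open import Data.List.Properties
  using (length-++; ++-assoc; take++drop≡id; take-all; take-[]; drop-all; drop-drop)
open import Data.List.Relation.Unary.All using (All; []; _∷_)
open import Data.List.Relation.Unary.All.Properties as All using (++⁺)
open import Data.List.Relation.Unary.Any using (here; there)
open import Data.Nat.Base
  using (ℕ; zero; suc; _+_; _*_; _∸_; _^_; _⊓_; _≤_; _<_; z≤n; s≤s; s≤s⁻¹; NonZero; >-nonZero)
import Data.Nat.ListAction as List
open import Data.Nat.Properties
open import Data.Product using (∃-syntax; _×_; _,_; proj₁; proj₂)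
open import Data.Sum.Base using (inj₁; inj₂)
open import Function.Base using (_∘_)
open import Function.Bundles using (_⇔_; mk⇔)
open import Relation.Binary.PropositionalEquality
  using (_≡_; _≢_; refl; sym; trans; cong; cong₂; subst; subst₂; module ≡-Reasoning)
open import Relation.Nullary.Decidable using (from-yes)
open import Relation.Nullary using (¬_; yes; no; does; contradiction)
open import Relation.Unary using (Decidable)

open Algebra.Properties.Semiring.Sum +-*-semiring
  using (sum; sum-cong-≗; ∑-comm; *-distribˡ-sum; *-distribʳ-sum)

private variable
  m n : ℕ

-- Finite sums

sum-const : ∀ n c → sum {n} (λ _ → c) ≡ n * c
sum-const zero    c = refl
sum-const (suc n) c = cong (c +_) (sum-const n c)

≤-sum : (f : Fin n → ℕ) → ∀ i → f i ≤ sum f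
≤-sum f zero    = m≤m+n _ _
≤-sum f (suc i) = m≤n⇒m≤o+n (f zero) (≤-sum (f ∘ suc) i)

+-≤-sum : (f : Fin n → ℕ) → ∀ {i j} → i ≢ j → f i + f j ≤ sum f
+-≤-sum f {zero}  {zero}  i≢j = contradiction refl i≢j
+-≤-sum f {zero}  {suc j} i≢j = +-monoʳ-≤ (f zero) (≤-sum (f ∘ suc) j)
+-≤-sum f {suc i} {zero}  i≢j =
  ≤-trans (≤-reflexive (+-comm (f (suc i)) (f zero))) (+-monoʳ-≤ (f zero) (≤-sum (f ∘ suc) i))
+-≤-sum f {suc i} {suc j} i≢j =
  m≤n⇒m≤o+n (f zero) (+-≤-sum (f ∘ suc) (i≢j ∘ cong suc))

sum-<⇒∃< : (f g : Fin n → ℕ) → sum f < sum g → ∃[ i ] f i < g i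
sum-<⇒∃< {suc n} f g lt with f zero <? g zero
... | yes f₀<g₀ = zero , f₀<g₀
... | no  f₀≮g₀ =
  let i , fᵢ<gᵢ = sum-<⇒∃< (f ∘ suc) (g ∘ suc)
        (+-cancelˡ-< (f zero) _ _ (<-≤-trans lt (+-monoˡ-≤ _ (≮⇒≥ f₀≮g₀))))
  in suc i , fᵢ<gᵢ

*<sum⇒∃< : ∀ c (f : Fin n → ℕ) → n * c < sum f → ∃[ i ] c < f i
*<sum⇒∃< {n} c f lt = sum-<⇒∃< (λ _ → c) f (subst (_< sum f) (sym (sum-const n c)) lt)

0<sum⇒∃0< : (f : Fin n → ℕ) → 0 < sum f → ∃[ i ] 0 < f i
0<sum⇒∃0< {n} f lt = *<sum⇒∃< 0 f (subst (_< sum f) (sym (*-zeroʳ n)) lt)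

-- Associativity for a row vector, a matrix and a column vector. The column is arbitrary, so
-- `live-growth` can apply it to one with entries capped at 1.
sum-*-assoc : (a : Fin m → ℕ) (B : Fin m → Fin n → ℕ) (c : Fin n → ℕ) →
  sum (λ j → sum (λ i → a i * B i j) * c j) ≡ sum (λ i → a i * sum (λ j → B i j * c j))
sum-*-assoc a B c = begin
  sum (λ j → sum (λ i → a i * B i j) * c j)
    ≡⟨ sum-cong-≗ (λ j → *-distribʳ-sum (c j) (λ i → a i * B i j)) ⟩
  sum (λ j → sum (λ i → a i * B i j * c j))
    ≡⟨ ∑-comm (λ j i → a i * B i j * c j) ⟩
  sum (λ i → sum (λ j → a i * B i j * c j))
    ≡⟨ sum-cong-≗ (λ i → sum-cong-≗ (λ j → *-assoc (a i) (B i j) (c j))) ⟩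
  sum (λ i → sum (λ j → a i * (B i j * c j)))
    ≡⟨ sum-cong-≗ (λ i → *-distribˡ-sum (a i) (λ j → B i j * c j)) ⟨
  sum (λ i → a i * sum (λ j → B i j * c j)) ∎
  where open ≡-Reasoning

0<*⁻ : ∀ m n → 0 < m * n → 0 < m × 0 < n
0<*⁻ (suc m) zero    lt with () ← subst (0 <_) (*-zeroʳ m) lt
0<*⁻ (suc m) (suc n) lt = s≤s z≤n , s≤s z≤n

-- Words and their products

prod : List (Matrix n) → Matrix n
prod = foldr _·_ I

repeat : ℕ → List (Matrix n) → List (Matrix n)
repeat k w = concat (replicate k w)

sum-I-* : ∀ (i : Fin n) (g : Fin n → ℕ) → sum (λ k → I i k * g k) ≡ g i
sum-I-* {suc n} zero    g = begin
  g zero + 0 + sum {n} (λ _ → 0)  ≡⟨ cong₂ _+_ (+-identityʳ (g zero)) (trans (sum-const n 0) (*-zeroʳ n)) ⟩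
  g zero + 0                      ≡⟨ +-identityʳ (g zero) ⟩
  g zero                          ∎
  where open ≡-Reasoning
sum-I-* (suc i) g = sum-I-* i (g ∘ suc)

I≤1 : ∀ (i j : Fin n) → I i j ≤ 1
I≤1 i j with does (i Fin.≟ j)
... | true  = ≤-refl
... | false = z≤n

0<I : ∀ (i : Fin n) → 0 < I i i
0<I i with i Fin.≟ i
... | yes _   = ≤-refl
... | no  i≢i = contradiction refl i≢i

prod-++ : ∀ (w v : List (Matrix n)) i j → prod (w ++ v) i j ≡ (prod w · prod v) i j
prod-++ []      v i j = sym (sum-I-* i (λ k → prod v k j))
prod-++ (A ∷ w) v i j = begin
  sum (λ k → A i k * prod (w ++ v) k j)
    ≡⟨ sum-cong-≗ (λ k → cong (A i k *_) (prod-++ w v k j)) ⟩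
  sum (λ k → A i k * sum (λ l → prod w k l * prod v l j))
    ≡⟨ sum-*-assoc (A i) (prod w) (λ l → prod v l j) ⟨
  sum (λ l → sum (λ k → A i k * prod w k l) * prod v l j) ∎
  where open ≡-Reasoning

*-≤-prod-++ : ∀ (w v : List (Matrix n)) i k j → prod w i k * prod v k j ≤ prod (w ++ v) i j
*-≤-prod-++ w v i k j = subst (prod w i k * prod v k j ≤_) (sym (prod-++ w v i j))
  (≤-sum (λ l → prod w i l * prod v l j) k)

0<prod-++⁺ : ∀ (w v : List (Matrix n)) {i k j} →
  0 < prod w i k → 0 < prod v k j → 0 < prod (w ++ v) i j
0<prod-++⁺ w v {i} {k} {j} 0<w 0<v = ≤-trans (*-mono-≤ 0<w 0<v) (*-≤-prod-++ w v i k j)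

0<prod-++⁻ : ∀ (w v : List (Matrix n)) {i j} → 0 < prod (w ++ v) i j →
  ∃[ k ] 0 < prod w i k × 0 < prod v k j
0<prod-++⁻ w v {i} {j} lt =
  let k , 0<wv = 0<sum⇒∃0< _ (subst (0 <_) (prod-++ w v i j) lt)
  in k , 0<*⁻ (prod w i k) _ 0<wv

entry≤norm : ∀ (A : Matrix n) i j → A i j ≤ ‖ A ‖
entry≤norm A i j = ≤-trans (≤-sum (A i) j) (≤-sum (λ i → sum (A i)) i)

norm<⇒entry< : ∀ c (A : Matrix n) → n * (n * c) < ‖ A ‖ → ∃[ i ] ∃[ j ] c < A i j
norm<⇒entry< c A lt =
  let i , lt′ = *<sum⇒∃< _ (λ i → sum (A i)) lt in i , *<sum⇒∃< c (A i) lt′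

norm≤sum : ∀ {A : Matrix n} {Σ} → A ∈ Σ → ‖ A ‖ ≤ List.sum (map ‖_‖ Σ)
norm≤sum {A = A}      (here refl)  = m≤m+n ‖ A ‖ _
norm≤sum {Σ = B ∷ _} (there A∈Σ) = m≤n⇒m≤o+n ‖ B ‖ (norm≤sum A∈Σ)

module _ {Σ : List (Matrix n)} where

  prod-∈ : ∀ {w} → All (_∈ Σ) w → prod w ∈ Σ ^ˢ length w
  prod-∈ []         = here refl
  prod-∈ (A∈Σ ∷ w⊆) = ∈-cartesianProductWith⁺ _·_ A∈Σ (prod-∈ w⊆)

  ∈⇒prod : ∀ t {A} → A ∈ Σ ^ˢ t → ∃[ w ] All (_∈ Σ) w × length w ≡ t × A ≡ prod w
  ∈⇒prod zero    (here refl) = [] , [] , refl , refl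
  ∈⇒prod (suc t) A∈
    with A , B , A∈Σ , B∈ , refl ← ∈-cartesianProductWith⁻ _·_ Σ (Σ ^ˢ t) A∈
    with w , w⊆ , refl , refl ← ∈⇒prod t B∈ =
    A ∷ w , A∈Σ ∷ w⊆ , refl , refl

  repeat⁺ : ∀ k {w} → All (_∈ Σ) w → All (_∈ Σ) (repeat k w)
  repeat⁺ zero    w⊆ = []
  repeat⁺ (suc k) w⊆ = ++⁺ w⊆ (repeat⁺ k w⊆)

length-repeat : ∀ k (w : List (Matrix n)) → length (repeat k w) ≡ k * length w
length-repeat zero    w = refl
length-repeat (suc k) w = trans (length-++ w) (cong (length w +_) (length-repeat k w))

repeat-+ : ∀ k l (w : List (Matrix n)) i j →
  prod (repeat (k + l) w) i j ≡ prod (repeat k w ++ repeat l w) i j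
repeat-+ k l w i j = cong (λ v → prod v i j) (eq k)
  where
  eq : ∀ k → repeat (k + l) w ≡ repeat k w ++ repeat l w
  eq zero    = refl
  eq (suc k) = trans (cong (w ++_) (eq k)) (sym (++-assoc w (repeat k w) (repeat l w)))

^≤prod-repeat : ∀ k (w : List (Matrix n)) i → prod w i i ^ k ≤ prod (repeat k w) i i
^≤prod-repeat zero    w i = 0<I i
^≤prod-repeat (suc k) w i = ≤-trans
  (*-monoʳ-≤ (prod w i i) (^≤prod-repeat k w i)) (*-≤-prod-++ w (repeat k w) i i i)

-- A walk can stay at `i` for some copies of `w`, cross to `j` during the next one and stay there
-- for the rest; the `k` choices of the crossing give distinct walks.
≤prod-repeat : ∀ k (w : List (Matrix n)) {i j} → i ≢ j →
  0 < prod w i i → 0 < prod w i j → 0 < prod w j j → k ≤ prod (repeat k w) i j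
≤prod-repeat zero    w i≢j _ _ _ = z≤n
≤prod-repeat (suc k) w {i} {j} i≢j 0<wᵢᵢ 0<wᵢⱼ 0<wⱼⱼ = begin
  suc k             ≡⟨ cong suc (*-identityˡ k) ⟨
  1 + 1 * k         ≡⟨ +-comm 1 (1 * k) ⟩
  -- The first copy is spent either at `i` or on the crossing.
  1 * k + 1 * 1     ≤⟨ +-mono-≤ (*-mono-≤ 0<wᵢᵢ (≤prod-repeat k w i≢j 0<wᵢᵢ 0<wᵢⱼ 0<wⱼⱼ))
                                (*-mono-≤ 0<wᵢⱼ 0<vⱼⱼ) ⟩
  w′ i + w′ j       ≤⟨ +-≤-sum w′ i≢j ⟩
  sum w′            ≡⟨ prod-++ w v i j ⟨
  prod (w ++ v) i j ∎
  where
  open ≤-Reasoning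
  v = repeat k w
  w′ = λ l → prod w i l * prod v l j
  0<vⱼⱼ : 0 < prod v j j
  0<vⱼⱼ = ≤-trans (m^n>0 (prod w j j) {{>-nonZero 0<wⱼⱼ}} k) (^≤prod-repeat k w j)

-- Sequences of positions

take-+ : ∀ {A : Set} s d (xs : List A) → take (s + d) xs ≡ take s xs ++ take d (drop s xs)
take-+ zero    d xs       = refl
take-+ (suc s) d []       = sym (take-[] d)
take-+ (suc s) d (x ∷ xs) = cong (x ∷_) (take-+ s d xs)

last-below : ∀ {P : ℕ → Set} → Decidable P → P 0 → ∀ t →
  ∃[ s ] s ≤ t × P s × (∀ r → s < r → r ≤ t → ¬ P r)
last-below P? P₀ zero = 0 , z≤n , P₀ , λ r 0<r r≤0 → contradiction (<-≤-trans 0<r r≤0) (n≮n 0)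
last-below P? P₀ (suc t) with P? (suc t)
... | yes Pₜ = suc t , ≤-refl , Pₜ , λ r t<r r≤t → contradiction (<-≤-trans t<r r≤t) (n≮n (suc t))
... | no ¬Pₜ =
  let s , s≤t , Pₛ , after = last-below P? P₀ t in
  s , m≤n⇒m≤1+n s≤t , Pₛ , λ r s<r r≤1+t Pᵣ →
    after r s<r (s≤s⁻¹ (≤∧≢⇒< r≤1+t λ { refl → ¬Pₜ Pᵣ })) Pᵣ

-- Jump from the first position to the last one of the same colour: that
-- colour does not occur afterwards.
repeated-colour-growth : ∀ a {{_ : NonZero a}} {M} k (P : Subset M) → ∣ P ∣ ≤ k →
  (f : ℕ → ℕ) (colour : ℕ → Fin M) → (∀ s → f (suc s) ≤ a * f s) →
  ∀ t → (∀ s → s ≤ t → colour s ∈ˢ P) → (a * a) ^ k * f 0 < f t →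
  ∃[ s ] ∃[ s′ ] s ≤ s′ × colour s ≡ colour s′ × a * f s < f s′
repeated-colour-growth a zero P ∣P∣≤0 f colour step t inP big =
  contradiction (<-≤-trans (x∈p⇒∣p-x∣<∣p∣ (inP 0 z≤n)) ∣P∣≤0) (λ ())
repeated-colour-growth a (suc k) P ∣P∣≤1+k f colour step t inP big
  with s , s≤t , cₛ≡c₀ , after ← last-below (λ s → colour s Fin.≟ colour 0) refl t
  with a * f 0 <? f s
... | yes lt = 0 , s , z≤n , sym cₛ≡c₀ , lt
... | no ≮ with m≤n⇒m<n∨m≡n s≤t
-- The colour of 0 recurs at the end, so `f t ≤ a * f 0`, while `a ≤ (a * a) ^ suc k`.
...   | inj₂ refl = contradiction big (≤⇒≯ (≤-trans (≮⇒≥ ≮) (*-monoˡ-≤ (f 0) a≤)))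
  where
  instance _ = m*n≢0 a a
           _ = m^n≢0 (a * a) k
  a≤ : a ≤ a * a * (a * a) ^ k
  a≤ = ≤-trans (m≤m*n a a) (m≤m*n (a * a) ((a * a) ^ k))
...   | inj₁ s<t =
  -- Restarting at `suc s` costs one factor `a * a`: one `a` bounds the growth from 0 to `s`, the
  -- other the step from `s` to `suc s`.
  let r , r′ , r≤r′ , c≡ , lt = repeated-colour-growth a k (P - colour 0)
        (s≤s⁻¹ (<-≤-trans (x∈p⇒∣p-x∣<∣p∣ (inP 0 z≤n)) ∣P∣≤1+k))
        (λ r → f (r + suc s)) (λ r → colour (r + suc s)) (λ r → step (r + suc s))
        (t ∸ suc s)
        (λ r r≤ → let ≤t = subst (r + suc s ≤_) t≡ (+-monoˡ-≤ (suc s) r≤) in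
          x∈p∧x≢y⇒x∈p-y (inP (r + suc s) ≤t) (after (r + suc s) (m≤n+m (suc s) r) ≤t))
        (≤-<-trans smaller (subst (λ t → (a * a) ^ suc k * f 0 < f t) (sym t≡) big))
  in r + suc s , r′ + suc s , +-monoˡ-≤ (suc s) r≤r′ , c≡ , lt
  where
  t≡ : t ∸ suc s + suc s ≡ t
  t≡ = m∸n+n≡m s<t
  open ≤-Reasoning
  smaller : (a * a) ^ k * f (suc s) ≤ (a * a) ^ suc k * f 0
  smaller = begin
    (a * a) ^ k * f (suc s)        ≤⟨ *-monoʳ-≤ ((a * a) ^ k) (step s) ⟩
    (a * a) ^ k * (a * f s)        ≤⟨ *-monoʳ-≤ ((a * a) ^ k) (*-monoʳ-≤ a (≮⇒≥ ≮)) ⟩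
    (a * a) ^ k * (a * (a * f 0))  ≡⟨ cong ((a * a) ^ k *_) (*-assoc a a (f 0)) ⟨
    (a * a) ^ k * (a * a * f 0)    ≡⟨ *-assoc ((a * a) ^ k) (a * a) (f 0) ⟨
    (a * a) ^ k * (a * a) * f 0    ≡⟨ cong (_* f 0) (*-comm ((a * a) ^ k) (a * a)) ⟩
    (a * a) ^ suc k * f 0          ∎

orbit : ∀ {A : Set} {P : A → Set} {R : A → A → Set} →
  (∀ {x} → P x → ∃[ y ] P y × R x y) → ∀ {x} → P x →
  ∃[ xs ] x ≡ xs 0 × (∀ i → R (xs i) (xs (suc i)))
orbit {A} {P} next {x} Px =
  (λ i → proj₁ (states i)) , refl , (λ i → proj₂ (proj₂ (next (proj₂ (states i)))))
  where
  states : ℕ → ∃[ x ] P x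
  states zero    = x , Px
  states (suc i) = let y , Py , _ = next (proj₂ (states i)) in y , Py

-- Walks along powers of a word

module _ {n} (w : List (Matrix n)) where

  Walk : ℕ → Fin n → Fin n → Set
  Walk k i j = 0 < prod (repeat k w) i j

  walk-trans : ∀ k l {i h j} → Walk k i h → Walk l h j → Walk (k + l) i j
  walk-trans k l {i} {h} {j} p q = subst (0 <_) (sym (repeat-+ k l w i j))
    (0<prod-++⁺ (repeat k w) (repeat l w) p q)

  walk-split : ∀ k l {i j} → Walk (k + l) i j → ∃[ h ] Walk k i h × Walk l h j
  walk-split k l {i} {j} p =
    0<prod-++⁻ (repeat k w) (repeat l w) (subst (0 <_) (repeat-+ k l w i j) p)

  walk-loop : ∀ e d {i} → Walk d i i → Walk (e * d) i i
  walk-loop zero    d {i} p = 0<I i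
  walk-loop (suc e) d     p = walk-trans d (e * d) p (walk-loop e d p)

  Steps : (ℕ → Fin n) → Set
  Steps ys = ∀ i → 0 < prod w (ys i) (ys (suc i))

  CoSteps : (ℕ → Fin n) → Set
  CoSteps xs = ∀ i → 0 < prod w (xs (suc i)) (xs i)

  walk-along : ∀ {ys} → Steps ys → ∀ d i → Walk d (ys i) (ys (d + i))
  walk-along {ys} st zero    i = 0<I (ys i)
  walk-along {ys} st (suc d) i = 0<prod-++⁺ w (repeat d w) (st i)
    (subst (λ j → Walk d (ys (suc i)) (ys j)) (+-suc d i) (walk-along st d (suc i)))

  walk-back : ∀ {xs} → CoSteps xs → ∀ d i → Walk d (xs (d + i)) (xs i)
  walk-back {xs} st zero    i = 0<I (xs i)
  walk-back {xs} st (suc d) i = 0<prod-++⁺ w (repeat d w) (st (d + i)) (walk-back st d i)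

  -- The last two components serve the case `a ≡ b`: there they combine to a walk from `y` back to
  -- `x`.
  JoinedLoops : Fin n → Fin n → Set
  JoinedLoops x y = ∃[ a ] ∃[ b ] ∃[ N ] Walk N a a × Walk N a b × Walk N b b ×
    (∃[ k ] Walk k y b) × (∃[ l ] Walk l a x)

  -- The pair (xs i , ys i) recurs after d steps, so xs i and ys i lie on loops
  -- of length d; the endpoint is then moved along its loop until the walk
  -- joining the two loops has a length divisible by d.
  joined-loops : ∀ {xs ys} → CoSteps xs → Steps ys → 0 < prod w (xs 0) (ys 0) →
    JoinedLoops (xs 0) (ys 0)
  joined-loops {xs} {ys} back forth cross
    -- Pairs are pigeonholed so that both sequences recur with the same period.
    with i , j , i<j , same ← pigeonhole (n<1+n (n * n))
           (λ i → combine (xs (toℕ i)) (ys (toℕ i)))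
    with xᵢ≡xⱼ , yᵢ≡yⱼ ← combine-injective (xs (toℕ i)) (ys (toℕ i)) (xs (toℕ j)) (ys (toℕ j)) same =
    go (toℕ i) (toℕ j ∸ toℕ i) (m<n⇒0<n∸m i<j)
      (trans xᵢ≡xⱼ (cong xs (sym j≡))) (trans yᵢ≡yⱼ (cong ys (sym j≡)))
    where
    j≡ : toℕ j ∸ toℕ i + toℕ i ≡ toℕ j
    j≡ = m∸n+n≡m (<⇒≤ i<j)

    go : ∀ i d → 0 < d → xs i ≡ xs (d + i) → ys i ≡ ys (d + i) →
      JoinedLoops (xs 0) (ys 0)
    go i d@(suc d₀) 0<d xᵢ≡ yᵢ≡ =
      -- `e` is the length of the walk from `xs i` through `xs 0` and `ys 0` to `ys i`. A further
      -- `e * d₀` steps on the loop at `ys i` bring it to `e * d`.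
      let e    = i + suc i
          N≡   = +-comm e (e * d₀)
          at   = cong xs (+-identityʳ i)
          at′  = cong ys (+-identityʳ i)
          x→   = subst (λ z → Walk i z (xs 0)) at (walk-back back i 0)
          →y   = subst (Walk i (ys 0)) at′ (walk-along forth i 0)
          a↺   = subst (λ z → Walk d z (xs i)) (sym xᵢ≡) (walk-back back d i)
          b↺   = subst (Walk d (ys i)) (sym yᵢ≡) (walk-along forth d i)
          a→b  = walk-trans i (suc i) x→ (0<prod-++⁺ w (repeat i w) cross →y)
          b↺′  = subst (λ N → Walk N (ys i) (ys i)) (trans (*-suc e d₀) N≡) (walk-loop e d b↺)
          b′ , b→b′ , b′→b = walk-split (e * d₀) e b↺′
      in xs i , b′ , e + e * d₀
       , subst (λ N → Walk N (xs i) (xs i)) (*-suc e d₀) (walk-loop e d a↺)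
       , walk-trans e (e * d₀) a→b b→b′
       , walk-trans e (e * d₀) b′→b b→b′
       , (i + e * d₀ , walk-trans i (e * d₀) →y b→b′)
       , (i , x→)

-- Factorisations of a word: live walks and colours

-- live u v p q counts the walks from p along u which can be continued along v
-- to q (once for each state reached, however many continuations it has).
live : (u v : List (Matrix n)) → Fin n → Fin n → ℕ
live u v p q = sum (λ k → prod u p k * (1 ⊓ prod v k q))

0<1⊓ : ∀ {m} → 0 < m → 1 ⊓ m ≡ 1
0<1⊓ (s≤s _) = refl

-- Moving `x` into the prefix replaces the weight `h k` of each state `k` by `g k`. Some reachable
-- `k` has `g k` above `n * (c * h k)`, so one of the `n` summands of `g k` exceeds `c * h k`.
live-growth : ∀ c (u x v : List (Matrix n)) {p q} →
  n * c * live u (x ++ v) p q < live (u ++ x) v p q →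
  ∃[ k ] ∃[ l ] 0 < prod u p k × c < prod x k l × 0 < prod v l q
live-growth {n} c u x v {p} {q} grows =
  let k , lt = sum-<⇒∃< (λ k → n * c * (prod u p k * h k)) (λ k → prod u p k * g k) grows′
      0<uₖ , _ = 0<*⁻ (prod u p k) (g k) (≤-<-trans z≤n lt)
      lt′ = *-cancelˡ-< (prod u p k) (n * (c * h k)) (g k)
              (subst (_< prod u p k * g k) (rearrange k) lt)
      l , lt″ = *<sum⇒∃< (c * h k) (λ l → prod x k l * (1 ⊓ prod v l q)) lt′
      0<xₖₗ , 0<1⊓vₗ = 0<*⁻ (prod x k l) (1 ⊓ prod v l q) (≤-<-trans z≤n lt″)
      0<vₗ = m≤n⊓o⇒m≤o 1 (prod v l q) 0<1⊓vₗ
      -- The summand is positive, so `k` leads to `q` through `l` and its capped weight is 1.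
      hₖ≡1 = 0<1⊓ (0<prod-++⁺ x v {k} {l} {q} 0<xₖₗ 0<vₗ)
  in k , l , 0<uₖ
   , subst₂ _<_ (trans (cong (c *_) hₖ≡1) (*-identityʳ c))
                (trans (cong (prod x k l *_) (0<1⊓ 0<vₗ)) (*-identityʳ _)) lt″
   , 0<vₗ
  where
  open ≡-Reasoning
  g h : Fin n → ℕ
  g k = sum (λ l → prod x k l * (1 ⊓ prod v l q))
  h k = 1 ⊓ prod (x ++ v) k q

  rearrange : ∀ k → n * c * (prod u p k * h k) ≡ prod u p k * (n * (c * h k))
  rearrange k = begin
    n * c * (prod u p k * h k)    ≡⟨ *-assoc (n * c) (prod u p k) (h k) ⟨
    n * c * prod u p k * h k      ≡⟨ cong (_* h k) (*-comm (n * c) (prod u p k)) ⟩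
    prod u p k * (n * c) * h k    ≡⟨ *-assoc (prod u p k) (n * c) (h k) ⟩
    prod u p k * (n * c * h k)    ≡⟨ cong (prod u p k *_) (*-assoc n c (h k)) ⟩
    prod u p k * (n * (c * h k))  ∎

  grows′ : sum (λ k → n * c * (prod u p k * h k)) < sum (λ k → prod u p k * g k)
  grows′ = subst₂ _<_
    (*-distribˡ-sum (n * c) (λ k → prod u p k * h k))
    (trans (sum-cong-≗ (λ l → cong (_* (1 ⊓ prod v l q)) (prod-++ u x p l)))
           (sum-*-assoc (prod u p) (prod x) (λ l → 1 ⊓ prod v l q)))
    grows

positive : ℕ → Fin 2
positive zero    = zero
positive (suc _) = suc zero

positive-≡ : ∀ {k l} → positive k ≡ positive l → 0 < k → 0 < l
positive-≡ {suc k} {suc l} _ _ = s≤s z≤n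

-- The colour of a factorisation records which states are reachable from p
-- along u, and from which ones q is reachable along v.
colour : (u v : List (Matrix n)) → Fin n → Fin n → Fin ((2 * 2) ^ n)
colour u v p q = funToFin (λ k → combine (positive (prod u p k)) (positive (prod v k q)))

colour-≡ : ∀ (u v u′ v′ : List (Matrix n)) {p q} → colour u v p q ≡ colour u′ v′ p q → ∀ k →
  positive (prod u p k) ≡ positive (prod u′ p k) × positive (prod v k q) ≡ positive (prod v′ k q)
colour-≡ u v u′ v′ {p} {q} eq k = combine-injective
  (positive (prod u p k)) (positive (prod v k q)) (positive (prod u′ p k)) (positive (prod v′ k q))
  (trans (sym (finToFun-funToFin (code u v) k))
    (trans (cong (λ c → finToFun c k) eq) (finToFun-funToFin (code u′ v′) k)))
  where
  code : (u v : List (Matrix _)) → Fin _ → Fin (2 * 2)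
  code u v k = combine (positive (prod u p k)) (positive (prod v k q))

-- With equal colours before and after x, every state reachable from p has a
-- predecessor along x that is reachable from p, and every state leading to q
-- a successor along x that leads to q.
same-colour⇒joined-loops : ∀ (u x v : List (Matrix n)) {p q} →
  colour u (x ++ v) p q ≡ colour (u ++ x) v p q →
  ∀ {k l} → 0 < prod u p k → 0 < prod x k l → 0 < prod v l q → JoinedLoops x k l
same-colour⇒joined-loops {n} u x v {p} {q} same 0<u 0<x 0<v
  = join (orbit {R = λ i j → 0 < prod x j i} predecessor 0<u)
         (orbit {R = λ i j → 0 < prod x i j} successor 0<v) 0<x
  where
  join : ∀ {k l} → (∃[ xs ] k ≡ xs 0 × CoSteps x xs) → (∃[ ys ] l ≡ ys 0 × Steps x ys) →
    0 < prod x k l → JoinedLoops x k l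
  join (xs , refl , back) (ys , refl , forth) 0<x = joined-loops x back forth 0<x

  eq = colour-≡ u (x ++ v) (u ++ x) v same

  predecessor : ∀ {k} → 0 < prod u p k → ∃[ j ] 0 < prod u p j × 0 < prod x j k
  predecessor {k} 0<u = 0<prod-++⁻ u x (positive-≡ (proj₁ (eq k)) 0<u)

  successor : ∀ {k} → 0 < prod v k q → ∃[ j ] 0 < prod v j q × 0 < prod x k j
  successor {k} 0<v =
    let j , 0<x , 0<v′ = 0<prod-++⁻ x v (positive-≡ (sym (proj₂ (eq k))) 0<v) in j , 0<v′ , 0<x

-- Two joined loops and unbounded norms

TwoLoops : List (Matrix n) → Set
TwoLoops {n} Σ = ∃[ A ] A ∈⋆ Σ × (∃[ i ] ∃[ j ] i ≢ j × 1 ≤ A i i × 1 ≤ A i j × 1 ≤ A j j)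

module _ {n} (Σ : List (Matrix n)) (diag≤1 : ∀ w → All (_∈ Σ) w → ∀ i → prod w i i ≤ 1) where

  joined-loops⇒two-loops : ∀ {x} → All (_∈ Σ) x → ∀ {k l} → 1 < prod x k l →
    JoinedLoops x k l → TwoLoops Σ
  joined-loops⇒two-loops {x} x⊆ {k} {l} 1<xₖₗ (a , b , N , a↺ , a→b , b↺ , (r , l→b) , (s , a→k))
    with a Fin.≟ b
  ... | no  a≢b  =
    prod (repeat N x) , (length (repeat N x) , prod-∈ (repeat⁺ N x⊆)) , a , b , a≢b , a↺ , a→b , b↺
  -- The closed walk from `k` along `x` to `l`, then through `b` back to `k`, inherits the
  -- multiplicity `prod x k l`.
  ... | yes refl = contradiction (diag≤1 (x ++ repeat (r + s) x) (++⁺ x⊆ (repeat⁺ (r + s) x⊆)) k)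
    (<⇒≱ (<-≤-trans 1<xₖₗ (≤-trans
      (≤-trans (≤-reflexive (sym (*-identityʳ _))) (*-monoʳ-≤ (prod x k l) (walk-trans x r s l→b a→k)))
      (*-≤-prod-++ x (repeat (r + s) x) k l k))))

  -- The `suc` makes the bound positive: it then covers the empty factor past the end of a word, and
  -- any entry above it is at least 2.
  entryBound : ℕ
  entryBound = suc (List.sum (map ‖_‖ (Σ ^ˢ 1)))

  letter≤bound : ∀ {w} → All (_∈ Σ) w → ∀ i j → prod (take 1 w) i j ≤ entryBound
  letter≤bound []                   i j = ≤-trans (I≤1 i j) (s≤s z≤n)
  letter≤bound {A ∷ _} (A∈Σ ∷ _) i j = m≤n⇒m≤1+n
    (≤-trans (entry≤norm (prod (A ∷ [])) i j) (norm≤sum (prod-∈ (A∈Σ ∷ []))))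

  -- The threshold of `repeated-colour-growth`, with the number of colours as exponent.
  growthBound : ℕ
  growthBound = (n * entryBound * (n * entryBound)) ^ ((2 * 2) ^ n)

  large-entry⇒two-loops : ∀ {w} → All (_∈ Σ) w → ∀ {p q} → growthBound < prod w p q → TwoLoops Σ
  large-entry⇒two-loops {w} w⊆ {p} {q} big =
    let s , s′ , s≤s′ , same , grows = repeated-colour-growth a {{m*n≢0 n entryBound {{nonZeroIndex p}}}}
          ((2 * 2) ^ n) ⊤ (≤-reflexive (∣⊤∣≡n _)) f c step (length w) (λ _ _ → ∈⊤)
          (≤-<-trans initial (<-≤-trans big final))
    in found s (s′ ∸ s)
         (subst (λ r → c s ≡ c r) (sym (m+[n∸m]≡n s≤s′)) same)
         (subst (λ r → a * f s < f r) (sym (m+[n∸m]≡n s≤s′)) grows)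
    where
    a = n * entryBound
    f : ℕ → ℕ
    f s = live (take s w) (drop s w) p q
    c : ℕ → Fin ((2 * 2) ^ n)
    c s = colour (take s w) (drop s w) p q

    factor : ℕ → ℕ → List (Matrix n)
    factor s d = take d (drop s w)

    drop-+ : ∀ s d → drop s w ≡ factor s d ++ drop (s + d) w
    drop-+ s d = trans (sym (take++drop≡id d (drop s w))) (cong (factor s d ++_) (drop-drop s d w))

    grown : ∀ s d → a * f s < f (s + d) → ∃[ k ] ∃[ l ]
      0 < prod (take s w) p k × entryBound < prod (factor s d) k l × 0 < prod (drop (s + d) w) l q
    grown s d lt = live-growth entryBound (take s w) (factor s d) (drop (s + d) w)
      (subst₂ (λ v u → a * live (take s w) v p q < live u (drop (s + d) w) p q)
        (drop-+ s d) (take-+ s d w) lt)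

    step : ∀ s → f (suc s) ≤ a * f s
    -- Faster growth would give a single letter an entry above `entryBound`.
    step s = ≮⇒≥ λ lt →
      let k , l , _ , big , _ = grown s 1 (subst (λ r → a * f s < f r) (+-comm 1 s) lt)
      in <⇒≱ big (letter≤bound (All.drop⁺ s w⊆) k l)

    found : ∀ s d → c s ≡ c (s + d) → a * f s < f (s + d) → TwoLoops Σ
    found s d same lt =
      let k , l , 0<u , big , 0<v = grown s d lt
          same′ = subst₂ (λ v u → colour (take s w) v p q ≡ colour u (drop (s + d) w) p q)
                    (drop-+ s d) (take-+ s d w) same
          1<x = ≤-<-trans (s≤s z≤n) big
      in joined-loops⇒two-loops (All.take⁺ d (All.drop⁺ s w⊆)) 1<x
           (same-colour⇒joined-loops (take s w) (factor s d) (drop (s + d) w) same′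
             0<u (<-trans (s≤s z≤n) 1<x) 0<v)

    initial : growthBound * f 0 ≤ growthBound
    initial = begin
      -- The empty prefix reaches only `p`, so `f 0` is a single capped entry.
      growthBound * f 0               ≡⟨ cong (growthBound *_) (sum-I-* p (λ k → 1 ⊓ prod w k q)) ⟩
      growthBound * (1 ⊓ prod w p q)  ≤⟨ *-monoʳ-≤ growthBound (m⊓n≤m 1 _) ⟩
      growthBound * 1                 ≡⟨ *-identityʳ growthBound ⟩
      growthBound                     ∎
      where open ≤-Reasoning

    final : prod w p q ≤ f (length w)
    final = begin
      prod w p q                ≡⟨ *-identityʳ (prod w p q) ⟨
      prod w p q * 1            ≡⟨ cong (prod w p q *_) (0<1⊓ (0<I q)) ⟨
      prod w p q * (1 ⊓ I q q)  ≤⟨ ≤-sum (λ k → prod w p k * (1 ⊓ I k q)) q ⟩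
      live w [] p q             ≡⟨ cong₂ (λ u v → live u v p q)
                                     (take-all (length w) w ≤-refl) (drop-all (length w) w ≤-refl) ⟨
      f (length w)              ∎
      where open ≤-Reasoning

  unbounded⇒two-loops : Unbounded (Norms Σ) → TwoLoops Σ
  unbounded⇒two-loops unbounded
    -- A norm above this sums `n * n` entries, so one of them exceeds `growthBound`.
    with _ , (A , (t , A∈) , refl) , big ← unbounded (n * (n * growthBound))
    with w , w⊆ , refl , refl ← ∈⇒prod t A∈ =
    let _ , _ , big′ = norm<⇒entry< growthBound (prod w) big in large-entry⇒two-loops w⊆ big′

two-loops⇒unbounded : ∀ {Σ : List (Matrix n)} → TwoLoops Σ → Unbounded (Norms Σ)
two-loops⇒unbounded (A , (t , A∈) , i , j , i≢j , 0<ᵢᵢ , 0<ᵢⱼ , 0<ⱼⱼ) K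
  with w , w⊆ , refl , refl ← ∈⇒prod t A∈ =
  ‖ prod v ‖ , (prod v , (length v , prod-∈ (repeat⁺ (suc K) w⊆)) , refl) ,
  ≤-trans (≤prod-repeat (suc K) w i≢j 0<ᵢᵢ 0<ᵢⱼ 0<ⱼⱼ) (entry≤norm (prod v) i j)
  where v = repeat (suc K) w

-- Consequences of the joint spectral radius being 1

fromℕ-mono-≤ : ∀ {k l} → k ≤ l → fromℕ k ℚ.≤ fromℕ l
fromℕ-mono-≤ {k} {l} k≤l = ℚ.toℚᵘ-cancel-≤ (begin
  ℚ.toℚᵘ (fromℕ k)     ≃⟨ ℚ.toℚᵘ-fromℚᵘ (ℚᵘ.mkℚᵘ (ℤ.+ k) 0) ⟩
  ℚᵘ.mkℚᵘ (ℤ.+ k) 0    ≤⟨ ℚᵘ.*≤* (ℤ.*-monoʳ-≤-nonNeg (ℤ.+ 1) (ℤ.+≤+ k≤l)) ⟩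
  ℚᵘ.mkℚᵘ (ℤ.+ l) 0    ≃⟨ ℚ.toℚᵘ-fromℚᵘ (ℚᵘ.mkℚᵘ (ℤ.+ l) 0) ⟨
  ℚ.toℚᵘ (fromℕ l)     ∎)
  where open ℚᵘ.≤-Reasoning

fromℕ-* : ∀ k l → fromℕ (k * l) ≡ fromℕ k ℚ.* fromℕ l
fromℕ-* k l = ℚ.toℚᵘ-injective (begin
  ℚ.toℚᵘ (fromℕ (k * l))                         ≈⟨ ℚ.toℚᵘ-fromℚᵘ (ℚᵘ.mkℚᵘ (ℤ.+ (k * l)) 0) ⟩
  ℚᵘ.mkℚᵘ (ℤ.+ (k * l)) 0                        ≡⟨ cong (λ z → ℚᵘ.mkℚᵘ z 0) (ℤ.pos-* k l) ⟩
  ℚᵘ.mkℚᵘ (ℤ.+ k) 0 ℚᵘ.* ℚᵘ.mkℚᵘ (ℤ.+ l) 0       ≈⟨ ℚᵘ.*-cong (ℚ.toℚᵘ-fromℚᵘ (ℚᵘ.mkℚᵘ (ℤ.+ k) 0))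
                                                              (ℚ.toℚᵘ-fromℚᵘ (ℚᵘ.mkℚᵘ (ℤ.+ l) 0)) ⟨
  ℚ.toℚᵘ (fromℕ k) ℚᵘ.* ℚ.toℚᵘ (fromℕ l)         ≈⟨ ℚ.toℚᵘ-homo-* (fromℕ k) (fromℕ l) ⟨
  ℚ.toℚᵘ (fromℕ k ℚ.* fromℕ l)                   ∎)
  where open import Relation.Binary.Reasoning.Setoid ℚᵘ.≃-setoid

fromℕ-^ : ∀ k m → fromℕ (k ^ m) ≡ fromℕ k ^ℚ m
fromℕ-^ k zero    = refl
fromℕ-^ k (suc m) = trans (fromℕ-* k (k ^ m)) (cong (fromℕ k ℚ.*_) (fromℕ-^ k m))

max-U : ∀ {xs x q} → x ∈ xs → ℝ.U (max xs) q → ℝ.U x q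
max-U (here refl)  (u , _) = u
max-U (there x∈xs) (_ , u) = max-U x∈xs u

JSR≤1⇒norm< : ∀ (Σ : List (Matrix n)) → JointSpectralRadius Σ 1ᴿ → ∀ {r} → ℚ.1ℚ ℚ.< r →
  ∃[ N ] ∀ k → N ≤ k → ∀ {A} → A ∈ Σ ^ˢ suc k → fromℕ ‖ A ‖ ℚ.< r ^ℚ suc k
JSR≤1⇒norm< Σ jsr {r} 1<r =
  -- With this `ε`, the maximal root eventually lies below `1 + ε`, which is `r`.
  let ε       = r ℚ.- ℚ.1ℚ
      0<ε     = subst (ℚ._< ε) (ℚ.+-inverseʳ ℚ.1ℚ) (ℚ.+-monoˡ-< (ℚ.- ℚ.1ℚ) 1<r)
      N , lim = jsr ε 0<ε
  in N , λ k N≤k {A} A∈ →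
    let (q , uq , q-ε<1) , _ = lim k N≤k
        0<q , lt = max-U (∈-map⁺ (λ A → root k ‖ A ‖) A∈) uq
        q<r = subst₂ ℚ._<_ (p-q+q≡p q ε) (trans (ℚ.+-comm ℚ.1ℚ ε) (p-q+q≡p r ℚ.1ℚ))
                (ℚ.+-monoˡ-< ε q-ε<1)
    in ℚ.<-trans lt (^-mono-< k (ℚ.<⇒≤ 0<q) q<r)

-- Let `t` be the length of `w`. An entry of at least 2 gives the `m`-th power of `w` a norm of at
-- least `2 ^ m`, whereas for `r > 1` with `r ^ t < 2` the norm is eventually below `r ^ (t * m)`.
JSR≤1⇒diag≤1 : ∀ (Σ : List (Matrix n)) → JointSpectralRadius Σ 1ᴿ →
  ∀ w → All (_∈ Σ) w → ∀ i → prod w i i ≤ 1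
JSR≤1⇒diag≤1 Σ jsr []         w⊆ i = I≤1 i i
JSR≤1⇒diag≤1 Σ jsr w@(_ ∷ w′) w⊆ i = ≮⇒≥ λ 2≤wᵢᵢ →
  let t             = length w
      r , 1<r , rᵗ<2 = ^-open-< t (ℚ.nonNegative⁻¹ ℚ.1ℚ)
                         (subst (ℚ._< fromℕ 2) (sym (1^≡1 t)) (from-yes (ℚ.1ℚ ℚ.<? fromℕ 2)))
      N , small     = JSR≤1⇒norm< Σ jsr 1<r
      -- `suc k` is `t * suc N`, the length of `v`, because `maxRoot` at index `k` concerns products
      -- of length `suc k`.
      k             = N + length w′ * suc N
      v             = repeat (suc N) w
      v∈            = subst (λ l → prod v ∈ Σ ^ˢ l)
                        (trans (length-repeat (suc N) w) (*-comm (suc N) t)) (prod-∈ (repeat⁺ (suc N) w⊆))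
      2ᴺ≤v          = ≤-trans (^-monoˡ-≤ (suc N) 2≤wᵢᵢ)
                        (≤-trans (^≤prod-repeat (suc N) w i) (entry≤norm (prod v) i i))
      large         = ℚ.≤-<-trans (fromℕ-mono-≤ 2ᴺ≤v) (small k (m≤m+n N _) v∈)
      power         = ^-mono-≤ (suc N) (0≤^ t (ℚ.≤-trans (ℚ.nonNegative⁻¹ ℚ.1ℚ) (ℚ.<⇒≤ 1<r))) (ℚ.<⇒≤ rᵗ<2)
  in ℚ.<-irrefl (fromℕ-^ 2 (suc N))
       (ℚ.<-≤-trans large (subst (ℚ._≤ fromℕ 2 ^ℚ suc N) (^-assocʳ r t (suc N)) power))
  where
  open Algebra.Properties.Semiring.Exp
    (CommutativeRing.semiring ℚ.+-*-commutativeRing) using (^-assocʳ)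
  1^≡1 : ∀ t → ℚ.1ℚ ^ℚ t ≡ ℚ.1ℚ
  1^≡1 zero    = refl
  1^≡1 (suc t) = trans (ℚ.*-identityˡ _) (1^≡1 t)

proposition2 : ∀ (n : ℕ) (Σ : List (Matrix n)) → Σ ≢ [] → JointSpectralRadius Σ 1ᴿ →
    Unbounded (Norms Σ) ⇔
    (∃[ A ] A ∈⋆ Σ × (∃[ i ] ∃[ j ] i ≢ j × 1 ≤ A i i × 1 ≤ A i j × 1 ≤ A j j))
proposition2 n Σ _ jsr = mk⇔ (unbounded⇒two-loops Σ (JSR≤1⇒diag≤1 Σ jsr)) two-loops⇒unbounded
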